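{- Let $U$ be a set, let $G=(V,A)$ be a symmetric digraph with $V\subseteq U$ and $A\subseteq V\times V$ (that is, $(x,y)\in A$ implies $(y,x)\in A$), and let $w:U\times U\to\mathbb{R}$ satisfy $w(v_1,v_2)=w(v_2,v_1)$ for all $v_1,v_2\in U$. Then for every finite list $es=[(x_1,y_1),\ldots,(x_k,y_k)]$ of elements of $U\times U$, the list $es$ is a decreasing trail of $(G,w)$ if and only if the list $[(y_k,x_k),\ldots,(y_1,x_1)]$, obtained by swapping the endpoints of every edge and reversing the order, is an increasing trail of $(G,w)$.
   Context: A finite list $[a_1,\ldots,a_k]$ ($k\ge 0$) of pairs $a_i=(x_i,y_i)\in U\times U$ is a decreasing trail of $(G,w)$ if $a_i\in A$ for all $1\le i\le k$, and for all $1\le i<k$ one has $y_i=x_{i+1}$ and $w(a_i)>w(a_{i+1})$. It is an increasing trail of $(G,w)$ if the same holds with $w(a_i)<w(a_{i+1})$ in place of $w(a_i)>w(a_{i+1})$. The empty list is both a decreasing and an increasing trail. -}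

module Defs where

open import Data.List using (List; map; reverse)
open import Data.List.Relation.Unary.All using (All)
open import Data.List.Relation.Unary.Linked using (Linked)
open import Data.Product using (_×_; _,_; ∃; proj₁; proj₂; swap)
open import Data.Rational as ℚ using (ℚ)
open import Data.Sum using (_⊎_)
open import Function.Bundles using (_⇔_)
open import Level using (Level; 0ℓ; suc; _⊔_)
open import Relation.Binary.PropositionalEquality using (_≡_)
open import Relation.Nullary using (¬_)
open import Relation.Unary using (Pred; _∈_; _⊆_; _≐_; _⟨×⟩_; Satisfiable)

private
  variable
    u v a : Level

-- Dedekind reals: a real x is the cut with lower = {q | q < x} and
-- upper = {q | x < q}.
record ℝ : Set₁ where
  field
    lower upper     : Pred ℚ 0ℓ
    lower-inhabited : Satisfiable lower
    upper-inhabited : Satisfiable upper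
    lower-rounded   : ∀ p → p ∈ lower ⇔ ∃ λ q → p ℚ.< q × q ∈ lower
    upper-rounded   : ∀ q → q ∈ upper ⇔ ∃ λ p → p ℚ.< q × p ∈ upper
    disjoint        : ∀ q → ¬ (q ∈ lower × q ∈ upper)
    located         : ∀ p q → p ℚ.< q → p ∈ lower ⊎ q ∈ upper

open ℝ

infix 4 _≃_ _<_ _>_

-- Equality of real numbers; _≡_ on the record ℝ would be too fine, as it
-- also compares the proofs in a cut.
_≃_ : ℝ → ℝ → Set
x ≃ y = lower x ≐ lower y × upper x ≐ upper y

_<_ : ℝ → ℝ → Set
x < y = ∃ λ q → q ∈ upper x × q ∈ lower y

_>_ : ℝ → ℝ → Set
x > y = y < x

record Digraph (U : Set u) v a : Set (u ⊔ suc (v ⊔ a)) where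
  field
    V     : Pred U v
    A     : Pred (U × U) a
    A⊆V×V : A ⊆ (V ⟨×⟩ V)

open Digraph

SymmetricDigraph : {U : Set u} → Digraph U v a → Set (u ⊔ a)
SymmetricDigraph G = ∀ {x y} → (x , y) ∈ A G → (y , x) ∈ A G

SymmetricWeight : {U : Set u} → (U × U → ℝ) → Set u
SymmetricWeight w = ∀ v₁ v₂ → w (v₁ , v₂) ≃ w (v₂ , v₁)

DecreasingTrail : {U : Set u} → Digraph U v a → (U × U → ℝ) →
                  List (U × U) → Set (u ⊔ a)
DecreasingTrail G w es =
  All (_∈ A G) es ×
  Linked (λ e f → proj₂ e ≡ proj₁ f × w e > w f) es

IncreasingTrail : {U : Set u} → Digraph U v a → (U × U → ℝ) →
                  List (U × U) → Set (u ⊔ a)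
IncreasingTrail G w es =
  All (_∈ A G) es ×
  Linked (λ e f → proj₂ e ≡ proj₁ f × w e < w f) es

reverseTrail : {U : Set u} → List (U × U) → List (U × U)
reverseTrail es = reverse (map swap es)

{-# OPTIONS --safe #-}
module Submission where

open import Defs
open import Data.List using (List; []; _∷_; head; reverse; _ʳ++_)
open import Data.List.Properties using (reverse-involutive)
open import Data.List.Relation.Binary.Permutation.Propositional using (↭-sym)
open import Data.List.Relation.Binary.Permutation.Propositional.Properties
  using (All-resp-↭; ↭-reverse)
open import Data.List.Relation.Unary.All as All using (All)
import Data.List.Relation.Unary.All.Properties as All
open import Data.List.Relation.Unary.Linked as Linked
  using (Linked; []; [-]; _∷_; _∷′_)
import Data.List.Relation.Unary.Linked.Properties as Linked
open import Data.Maybe.Relation.Binary.Connected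
  using (Connected; just; just-nothing; nothing)
open import Data.Product using (_×_; _,_; swap)
open import Function.Base using (flip)
open import Function.Bundles using (_⇔_; mk⇔)
open import Level using (Level)
open import Relation.Binary.Core using (Rel)
open import Relation.Binary.PropositionalEquality using (sym; subst)

-- Being a trail is a condition on single edges and on adjacent pairs. Symmetry of `G` settles the
-- first, and order is irrelevant there. For the second, reversal turns each adjacent pair around,
-- so links by `R` become links by `flip R` (`Linked-reverse⁺`, `Linked-reverse⁻`). Swapping
-- endpoints restores head-to-tail incidence, and symmetric weights make the swap harmless to `<`
-- (`<-swap`), so only the direction of the comparison changes.

module _ {a ℓ} {A : Set a} {R : Rel A ℓ} where

  -- The accumulator `ys` makes the induction go through: the only adjacency not already inside `xs`
  -- or `ys` is the junction of their heads, which `Connected` covers, empty lists included.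
  Linked-ʳ++⁺ : ∀ {xs ys} → Linked R xs → Connected (flip R) (head xs) (head ys) →
                Linked (flip R) ys → Linked (flip R) (xs ʳ++ ys)
  Linked-ʳ++⁺ []          _ Rys = Rys
  Linked-ʳ++⁺ [-]         c Rys = c ∷′ Rys
  -- The head moves onto the accumulator: the old junction becomes an inner link there, and `Rxy`,
  -- read backwards, is the new junction.
  Linked-ʳ++⁺ (Rxy ∷ Rxs) c Rys = Linked-ʳ++⁺ Rxs (just Rxy) (c ∷′ Rys)

  Linked-reverse⁺ : ∀ {xs} → Linked R xs → Linked (flip R) (reverse xs)
  Linked-reverse⁺ {[]}    Rxs = Linked-ʳ++⁺ Rxs nothing []
  Linked-reverse⁺ {_ ∷ _} Rxs = Linked-ʳ++⁺ Rxs just-nothing []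

  Linked-reverse⁻ : ∀ {xs} → Linked R (reverse xs) → Linked (flip R) xs
  Linked-reverse⁻ {xs} Rxs =
    subst (Linked (flip R)) (reverse-involutive xs) (Linked-reverse⁺ Rxs)

<-resp-≃ : ∀ x x′ y y′ → x ≃ x′ → y ≃ y′ → x < y → x′ < y′
<-resp-≃ _ _ _ _ (_ , (upper⊆ , _)) ((lower⊆ , _) , _) (q , x<q , q<y) =
  q , upper⊆ x<q , lower⊆ q<y

mainTheorem6 : {u v a : Level} (U : Set u) (G : Digraph U v a) → SymmetricDigraph G →
    (w : U × U → ℝ) → SymmetricWeight w →
    (es : List (U × U)) →
    DecreasingTrail G w es ⇔ IncreasingTrail G w (reverseTrail es)
mainTheorem6 U G symG w symW es = mk⇔
  (λ (es⊆A , linked) →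
    All-resp-↭ (↭-sym (↭-reverse _)) (All.map⁺ (All.map symG es⊆A)) ,
    Linked-reverse⁺ (Linked.map⁺ (Linked.map
      (λ {e} {f} (e→f , we>wf) → sym e→f , <-swap f e we>wf)
      linked)))
  (λ (es⊆A , linked) →
    All.map symG (All.map⁻ (All-resp-↭ (↭-reverse _) es⊆A)) ,
    Linked.map
      -- The hypothesis compares swapped edges; a second swap returns the originals definitionally,
      -- by eta for pairs.
      (λ {e} {f} (f→e , wf<we) → sym f→e , <-swap (swap f) (swap e) wf<we)
      (Linked.map⁻ (Linked-reverse⁻ linked)))
  where
  <-swap : ∀ e f → w e < w f → w (swap e) < w (swap f)
  <-swap e@(x , y) f@(z , t) =
    <-resp-≃ (w e) (w (swap e)) (w f) (w (swap f)) (symW x y) (symW z t)
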